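{- Let $n$ be a positive integer and $g=3n+1$. The map $\sigma$ sends $\mathcal{G}_{2n}(g,q\le3)$ into $\mathcal{C}_{2n+1}(g+1)$ and is injective on $\mathcal{G}_{2n}(g,q\le 3)$. Moreover: (i) if $G\in\mathcal{G}_{2n}(g)$ has depth $2$ and multiplicity $m$, then $\sigma(G)$ is an $(m+1)$-set of depth $2$; (ii) if $G\in\mathcal{G}_{2n}(g)$ has depth $3$ and multiplicity $m$, then $\sigma(G)$ is an $(m+1)$-set of depth $3$.
   Context: A gapset is a finite set $G\subset\mathbb{N}=\{1,2,\dots\}$ such that whenever $z\in G$ and $z=x+y$ with $x,y\in\mathbb{N}$, then $x\in G$ or $y\in G$; its genus is $\#G$. Write $G=\{\ell_1<\dots<\ell_g\}$. Multiplicity $m(G)=\min\{s\in\mathbb{N}:s\notin G\}$; conductor $c(G)=\min\{s\in\mathbb{N}: s+t\notin G\ \forall t\in\mathbb{N}_0\}$; depth $q(G)=\lceil c(G)/m(G)\rceil$. $G$ is pure $\kappa$-sparse if $\ell_{i+1}-\ell_i\le\kappa$ for all $i$ with equality for some $i$; $\mathcal{G}_\kappa(g)$ is the set of pure $\kappa$-sparse gapsets of genus $g$ and $\mathcal{G}_\kappa(g,q\le3)$ those of depth at most $3$. $\mathcal{C}_\kappa(g)$ is the set of subsets of $[1,2g-1]$ with exactly $g$ elements whose maximum difference between consecutive elements (in increasing order) is exactly $\kappa$. For a positive integer $m$, an $m$-set is a set $M\subset\mathbb{N}$ with $[1,m-1]\subseteq M$ and $M\cap m\mathbb{N}=\emptyset$;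 its depth is $\lceil c/m\rceil$ where $c=\max M$. For $G\in\mathcal{G}_{2n}(g)$ let $\alpha=\max\{i:\ell_{i+1}-\ell_i=2n\}$ and $\sigma(G)=\{1\}\cup\{\ell_i+1:1\le i\le\alpha\}\cup\{\ell_i+2:\alpha+1\le i\le g\}$. -}

module Defs where

open import Data.Nat using (ℕ; zero; suc; _+_; _*_; _∸_; _/_; _≤_; _<_; z≤n; s≤s; NonZero; >-nonZero)
open import Data.Nat.Properties using (_≟_; _≤?_; ≤-refl; ≤-trans; <-irrefl; ≮⇒≥; n≤1+n; m≤m+n; m+[n∸m]≡n; +-monoˡ-≤; +-monoˡ-<; +-mono-<-≤)
open import Data.Nat.Divisibility using (_∣_)
open import Data.Fin using (toℕ)
open import Data.List using (List; []; _∷_; _++_; length; map; filter; take; drop; zipWith; lookup; allFin)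
open import Data.List.Extrema.Nat using (max; xs≤max; max≤v⁺)
open import Data.List.Relation.Unary.All as All using (All; []; _∷_)
import Data.List.Relation.Unary.All.Properties as All
open import Data.List.Relation.Unary.AllPairs as AllPairs using (AllPairs; []; _∷_)
import Data.List.Relation.Unary.AllPairs.Properties as AllPairs
import Data.List.Membership.Propositional as List
open import Data.List.Membership.DecPropositional _≟_ using (_∈?_)
open import Data.Product using (_×_; _,_; proj₁; proj₂; ∃)
open import Data.Sum using (_⊎_)
open import Function using (_∘_)
open import Function.Bundles using (_⇔_)
open import Level using (0ℓ)
open import Relation.Nullary using (¬_; yes; no; contradiction)
open import Relation.Nullary.Decidable using (_×-dec_; ¬?)
open import Relation.Unary using (Pred; Decidable)
open import Relation.Binary.PropositionalEquality using (_≡_; refl; sym; subst)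

-- A finite set of positive integers, given by its increasing enumeration
-- ℓ₁ < ℓ₂ < … < ℓ_g.
record FinSet : Set where
  constructor finSet
  field
    elements   : List ℕ
    positive   : All (1 ≤_) elements
    increasing : AllPairs _<_ elements

open FinSet public

infix 4 _∈_ _∉_ _≐_

_∈_ : ℕ → FinSet → Set
x ∈ A = x List.∈ elements A

_∉_ : ℕ → FinSet → Set
x ∉ A = ¬ (x ∈ A)

_≐_ : FinSet → FinSet → Set
A ≐ B = ∀ x → x ∈ A ⇔ x ∈ B

size : FinSet → ℕ
size A = length (elements A)

-- The list of ℓ_{i+1} − ℓ_i for 1 ≤ i < g; truncated subtraction is harmless
-- because the enumeration is increasing.
differences : FinSet → List ℕ
differences A = zipWith _∸_ (drop 1 (elements A)) (elements A)

MaxDifference : ℕ → Pred FinSet 0ℓ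
MaxDifference κ A = All (_≤ κ) (differences A) × κ List.∈ differences A

IsMin : Pred ℕ 0ℓ → ℕ → Set
IsMin P s = P s × (∀ {t} → P t → s ≤ t)

find-min : ∀ {P : Pred ℕ 0ℓ} → Decidable P → ∀ b → P b → ∃ (IsMin P)
find-min P? zero p = 0 , p , λ _ → z≤n
find-min {P} P? (suc b) p with P? 0
... | yes p₀ = 0 , p₀ , λ _ → z≤n
... | no ¬p₀ with find-min (P? ∘ suc) b p
...   | s , ps , s-min = suc s , ps , bound
  where
  bound : ∀ {t} → P t → suc s ≤ t
  bound {zero}  pt = contradiction pt ¬p₀
  bound {suc t} pt = s≤s (s-min pt)

>max⇒∉ : ∀ A {x} → max 0 (elements A) < x → x ∉ A
>max⇒∉ A lt x∈A = <-irrefl refl (≤-trans lt (All.lookup (xs≤max 0 (elements A)) x∈A))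

NonMember : FinSet → Pred ℕ 0ℓ
NonMember A s = 1 ≤ s × s ∉ A

NoMemberFrom : FinSet → Pred ℕ 0ℓ
NoMemberFrom A s = 1 ≤ s × (∀ t → s + t ∉ A)

multiplicity-exists : ∀ A → ∃ (IsMin (NonMember A))
multiplicity-exists A =
  find-min (λ s → (1 ≤? s) ×-dec ¬? (s ∈? elements A))
           (suc (max 0 (elements A))) (s≤s z≤n , >max⇒∉ A ≤-refl)

conductor-exists : ∀ A → ∃ (IsMin (NoMemberFrom A))
conductor-exists A =
  suc M , (s≤s z≤n , λ t → >max⇒∉ A (s≤s (m≤m+n M t))) , bound
  where
  M : ℕ
  M = max 0 (elements A)
  bound : ∀ {t} → NoMemberFrom A t → suc M ≤ t
  bound {suc t} (_ , none) = s≤s (max≤v⁺ z≤n (All.tabulate below))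
    where
    below : ∀ {x} → x ∈ A → x ≤ t
    below {x} x∈A with suc t ≤? x
    ... | yes t<x = contradiction (subst (_∈ A) (sym (m+[n∸m]≡n t<x)) x∈A) (none (x ∸ suc t))
    ... | no  t≮x = ≮⇒≥ t≮x

multiplicity : FinSet → ℕ
multiplicity A = proj₁ (multiplicity-exists A)

conductor : FinSet → ℕ
conductor A = proj₁ (conductor-exists A)

⌈_/_⌉ : (a b : ℕ) .{{_ : NonZero b}} → ℕ
⌈ a / b ⌉ = (a + (b ∸ 1)) / b

depth : FinSet → ℕ
depth A = ⌈ conductor A / multiplicity A ⌉
  where
  instance
    multiplicity-nonZero : NonZero (multiplicity A)
    multiplicity-nonZero = >-nonZero (proj₁ (proj₁ (proj₂ (multiplicity-exists A))))

IsGapset : Pred FinSet 0ℓ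
IsGapset G = ∀ x y → 1 ≤ x → 1 ≤ y → x + y ∈ G → x ∈ G ⊎ y ∈ G

𝒢 : ℕ → ℕ → Pred FinSet 0ℓ
𝒢 κ g G = IsGapset G × MaxDifference κ G × size G ≡ g

𝒢[q≤3] : ℕ → ℕ → Pred FinSet 0ℓ
𝒢[q≤3] κ g G = 𝒢 κ g G × depth G ≤ 3

𝒞 : ℕ → ℕ → Pred FinSet 0ℓ
𝒞 κ g A = All (_≤ 2 * g ∸ 1) (elements A) × size A ≡ g × MaxDifference κ A

IsMSet : ℕ → Pred FinSet 0ℓ
IsMSet m M =
  1 ≤ m × (∀ x → 1 ≤ x → x ≤ m ∸ 1 → x ∈ M) × (∀ x → m ∣ x → x ∉ M)

-- The maximum of the empty set (an m-set only for m = 1) is taken to be 0.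
mSetDepth : (m : ℕ) .{{_ : NonZero m}} → FinSet → ℕ
mSetDepth m M = ⌈ max 0 (elements M) / m ⌉

-- max { i : ℓ_{i+1} − ℓ_i = 2n } with indices counted from 1; it is 0 if there is
-- no such i, which does not happen for G in 𝒢 (2 * n) g.
α : ℕ → FinSet → ℕ
α n G = max 0 (map (suc ∘ toℕ) (filter (λ i → lookup (differences G) i ≟ 2 * n)
                                       (allFin (length (differences G)))))

-- The elements of {1} ∪ {ℓ_i + 1 : 1 ≤ i ≤ a} ∪ {ℓ_i + 2 : a + 1 ≤ i ≤ g}.
shift : ℕ → List ℕ → List ℕ
shift a ℓ = 1 ∷ (map (_+ 1) (take a ℓ) ++ map (_+ 2) (drop a ℓ))

shift-positive : ∀ a {ℓ} → All (1 ≤_) ℓ → All (1 ≤_) (shift a ℓ)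
shift-positive a pos = ≤-refl ∷
  All.++⁺ (All.map⁺ (All.map (λ {x} 1≤x → ≤-trans 1≤x (m≤m+n x 1)) (All.take⁺ a pos)))
          (All.map⁺ (All.map (λ {x} 1≤x → ≤-trans 1≤x (m≤m+n x 2)) (All.drop⁺ a pos)))

take<drop : ∀ a {ℓ} → AllPairs _<_ ℓ → All (λ x → All (x <_) (drop a ℓ)) (take a ℓ)
take<drop zero    _            = []
take<drop (suc a) []           = []
take<drop (suc a) (x<ℓ ∷ incr) = All.drop⁺ a x<ℓ ∷ take<drop a incr

shift-increasing : ∀ a {ℓ} → All (1 ≤_) ℓ → AllPairs _<_ ℓ → AllPairs _<_ (shift a ℓ)
shift-increasing a pos incr =
  All.++⁺ (All.map⁺ (All.map (+-monoˡ-≤ 1) (All.take⁺ a pos)))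
          (All.map⁺ (All.map (λ 1≤x → ≤-trans (n≤1+n 2) (+-monoˡ-≤ 2 1≤x)) (All.drop⁺ a pos)))
  ∷ AllPairs.++⁺
      (AllPairs.map⁺ (AllPairs.map (+-monoˡ-< 1) (AllPairs.take⁺ a incr)))
      (AllPairs.map⁺ (AllPairs.map (+-monoˡ-< 2) (AllPairs.drop⁺ a incr)))
      (All.map⁺ (All.map (λ x<ys → All.map⁺ (All.map (λ x<y → +-mono-<-≤ x<y (n≤1+n 1)) x<ys))
                         (take<drop a incr)))

σ : ℕ → FinSet → FinSet
σ n G = finSet (shift (α n G) (elements G))
               (shift-positive (α n G) (positive G))
               (shift-increasing (α n G) (positive G) (increasing G))

{-# OPTIONS --safe #-}
-- Let M = max G. Since M ∈ G, one of x and M − x lies in G for every 0 ≤ x ≤ M, so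
-- M + 1 ≤ 2g. Write ℓ_α = u and ℓ_{α+1} = u + 2n. The gap 2n + 1 created by σ after
-- position α is the only one of that length, so σ G determines α and hence G. As
-- [1, m − 1] ⊆ G, the long gap starts at u ≥ m − 1, so m + 1 ∉ σ G. If 2m + 2 ∈ σ G
-- then 2m + 1 ≤ u, so 2m + 1 + 2n ≤ M < 3m, which gives m ≥ 2n + 2 and M ≥ 6n + 5,
-- against M + 1 ≤ 2g = 6n + 2.
module Submission where

open import Defs
open import Data.Nat using (ℕ; zero; suc; _+_; _*_; _∸_; _/_; _%_; _≤_; _<_; z≤n; s≤s; s<s; NonZero; >-nonZero)
open import Data.Nat.DivMod using (m≡m%n+[m/n]*n; m%n<n; m*n/n≡m; /-monoˡ-≤; m<n*o⇒m/o<n)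
open import Data.Nat.Divisibility using (divides)
open import Data.Nat.Properties
open import Data.Nat.Tactic.RingSolver using (solve-∀)
open import Data.Fin using (Fin; zero; suc; toℕ)
open import Data.Fin.Properties using (injective⇒≤; toℕ-injective; toℕ≤pred[n])
open import Data.List using (List; []; _∷_; _++_; length; map; take; drop; zipWith; lookup; allFin)
open import Data.List.Extrema.Nat using (max; xs≤max; max≤v⁺; argmax-sel)
open import Data.List.Membership.Propositional using () renaming (_∈_ to _∈ₗ_)
open import Data.List.Membership.Propositional.Properties
  using (∈-map⁺; ∈-map⁻; ∈-++⁺ˡ; ∈-++⁺ʳ; ∈-++⁻; ∈-filter⁺; ∈-filter⁻; ∈-allFin)
open import Data.List.Membership.DecPropositional _≟_ using (_∈?_)
open import Data.List.Properties using (∷-injective; map-injective; length-++; length-map; take++drop≡id)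
open import Data.List.Relation.Unary.All as All using (All; []; _∷_)
open import Data.List.Relation.Unary.AllPairs using (AllPairs; []; _∷_)
open import Data.List.Relation.Unary.Any as Any using (here; there)
open import Data.List.Relation.Unary.Any.Properties using (lookup-index)
open import Data.List.Relation.Unary.Linked using (Linked; []; [-]; _∷_)
open import Data.Product using (_×_; _,_; proj₁; proj₂; ∃-syntax)
open import Data.Sum using (_⊎_; inj₁; inj₂; [_,_]′)
open import Function using (_∘_)
open import Function.Bundles using (mk⇔; Equivalence)
open import Relation.Nullary using (¬_; contradiction)
open import Relation.Nullary.Decidable using (decidable-stable)
open import Relation.Binary.PropositionalEquality using (_≡_; refl; sym; trans; cong; cong₂; subst)

-- Ceiling division, maxima and increasing lists.

⌈/⌉-bounds : ∀ {a b k} .{{_ : NonZero b}} → ⌈ a / b ⌉ ≡ suc k → k * b < a × a ≤ suc k * b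
⌈/⌉-bounds {a} {b@(suc c)} {k} eq = +-cancelʳ-< c (k * b) a lower , +-cancelʳ-≤ c a (suc k * b) upper
  where
  open ≤-Reasoning
  division : a + c ≡ (a + c) % b + suc k * b
  division = trans (m≡m%n+[m/n]*n (a + c) b) (cong (λ q → (a + c) % b + q * b) eq)
  lower : k * b + c < a + c
  lower = begin-strict
    k * b + c                   <⟨ +-monoʳ-< (k * b) (n<1+n c) ⟩
    k * b + b                   ≡⟨ +-comm (k * b) b ⟩
    suc k * b                   ≤⟨ m≤n+m _ _ ⟩
    (a + c) % b + suc k * b     ≡⟨ division ⟨
    a + c                       ∎
  upper : a + c ≤ suc k * b + c
  upper = begin
    a + c                       ≡⟨ division ⟩
    (a + c) % b + suc k * b     ≤⟨ +-monoˡ-≤ (suc k * b) (≤-pred (m%n<n (a + c) b)) ⟩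
    c + suc k * b               ≡⟨ +-comm c _ ⟩
    suc k * b + c               ∎

⌈/⌉-unique : ∀ {a b k} .{{_ : NonZero b}} → k * b < a → a ≤ suc k * b → ⌈ a / b ⌉ ≡ suc k
⌈/⌉-unique {a} {b@(suc c)} {k} lower upper = ≤-antisym
  (≤-pred (m<n*o⇒m/o<n (begin-strict
    a + c                 ≤⟨ +-monoˡ-≤ c upper ⟩
    suc k * b + c         <⟨ +-monoʳ-< (suc k * b) (n<1+n c) ⟩
    suc k * b + b         ≡⟨ +-comm (suc k * b) b ⟩
    suc (suc k) * b       ∎)))
  (begin
    suc k                 ≡⟨ m*n/n≡m (suc k) b ⟨
    (suc k * b) / b       ≤⟨ /-monoˡ-≤ b (begin
      suc (c + k * b)       ≡⟨ cong suc (+-comm c (k * b)) ⟩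
      suc (k * b) + c       ≤⟨ +-monoˡ-≤ c lower ⟩
      a + c                 ∎) ⟩
    (a + c) / b           ∎)
  where open ≤-Reasoning

-- `max` may return its default `0`; a positive entry rules that out.
max-∈ : ∀ {x xs} → 1 ≤ x → x ∈ₗ xs → max 0 xs ∈ₗ xs
max-∈ {x} {xs} 1≤x x∈xs with argmax-sel (λ y → y) 0 xs
... | inj₂ max∈xs = max∈xs
... | inj₁ max≡0 =
  contradiction (≤-trans 1≤x (subst (x ≤_) max≡0 (All.lookup (xs≤max 0 xs) x∈xs))) λ ()

-- Pigeonhole: a value is recovered from any index at which it occurs, so choosing indices is
-- injective. Repetitions in `xs` are allowed, because the cover in `∈⇒<2*size` may overlap itself.
⊆-range⇒≤ : ∀ k (xs : List ℕ) → (∀ x → x ≤ k → x ∈ₗ xs) → suc k ≤ length xs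
⊆-range⇒≤ k xs ⊆xs = injective⇒≤ {f = position} λ {i} {j} eq →
  toℕ-injective (trans (at i) (trans (cong (lookup xs) eq) (sym (at j))))
  where
  position : Fin (suc k) → Fin (length xs)
  position i = Any.index (⊆xs (toℕ i) (toℕ≤pred[n] i))
  at : ∀ i → toℕ i ≡ lookup xs (position i)
  at i = lookup-index (⊆xs (toℕ i) (toℕ≤pred[n] i))

-- Both heads are the least member of the same set, hence equal, and removing them leaves tails with
-- the same members.
increasing-≡ : ∀ {xs ys} → AllPairs _<_ xs → AllPairs _<_ ys →
               (∀ {z} → z ∈ₗ xs → z ∈ₗ ys) → (∀ {z} → z ∈ₗ ys → z ∈ₗ xs) → xs ≡ ys
increasing-≡ {[]}     {[]}     _ _ _ _ = refl
increasing-≡ {[]}     {y ∷ ys} _ _ _ ys⊆ with () ← ys⊆ (here refl)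
increasing-≡ {x ∷ xs} {[]}     _ _ xs⊆ _ with () ← xs⊆ (here refl)
increasing-≡ {x ∷ xs} {y ∷ ys} (x< ∷ xs↗) (y< ∷ ys↗) xs⊆ ys⊆ =
  cong₂ _∷_ x≡y (increasing-≡ xs↗ ys↗
    (λ z∈ → tail (sym x≡y) (All.lookup x< z∈) (xs⊆ (there z∈)))
    (λ z∈ → tail x≡y (All.lookup y< z∈) (ys⊆ (there z∈))))
  where
  head≤ : ∀ {a b bs} → All (b <_) bs → a ∈ₗ b ∷ bs → b ≤ a
  head≤ _  (here refl) = ≤-refl
  head≤ b< (there a∈)  = <⇒≤ (All.lookup b< a∈)
  x≡y : x ≡ y
  x≡y = ≤-antisym (head≤ x< (ys⊆ (here refl))) (head≤ y< (xs⊆ (here refl)))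
  tail : ∀ {a b z cs} → a ≡ b → b < z → z ∈ₗ a ∷ cs → z ∈ₗ cs
  tail refl b<z (here refl) = contradiction b<z (<-irrefl refl)
  tail _    _   (there z∈)  = z∈

-- Gaps between consecutive list entries

gaps : List ℕ → List ℕ
gaps ℓ = zipWith _∸_ (drop 1 ℓ) ℓ

-- The additive form avoids truncated subtraction when entries are shifted.
GapsWithin : ℕ → List ℕ → Set
GapsWithin κ = Linked (λ x y → y ≤ κ + x)

gaps≤⇒within : ∀ {κ} ℓ → All (_≤ κ) (gaps ℓ) → GapsWithin κ ℓ
gaps≤⇒within []           _        = []
gaps≤⇒within (x ∷ [])     _        = [-]
gaps≤⇒within {κ} (x ∷ y ∷ ℓ)  (p ∷ ps) =
  ≤-trans (m≤n+m∸n y x) (≤-trans (+-monoʳ-≤ x p) (≤-reflexive (+-comm x κ)))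
  ∷ gaps≤⇒within (y ∷ ℓ) ps

within⇒gaps≤ : ∀ {κ ℓ} → GapsWithin κ ℓ → All (_≤ κ) (gaps ℓ)
within⇒gaps≤ []      = []
within⇒gaps≤ [-]     = []
within⇒gaps≤ {κ} (_∷_ {x} {y} p ps) =
  m≤n+o⇒m∸n≤o y x (≤-trans p (≤-reflexive (+-comm κ x))) ∷ within⇒gaps≤ ps

-- GapAt κ i ℓ: the entry at position i (counted from 1) is followed by a gap of κ.
data GapAt (κ : ℕ) : ℕ → List ℕ → Set where
  here  : ∀ {x ℓ} → GapAt κ 1 (x ∷ κ + x ∷ ℓ)
  there : ∀ {i x y ℓ} → GapAt κ (suc i) (y ∷ ℓ) → GapAt κ (suc (suc i)) (x ∷ y ∷ ℓ)

lookup⇒GapAt : ∀ {κ} ℓ i → 1 ≤ κ → lookup (gaps ℓ) i ≡ κ → GapAt κ (suc (toℕ i)) ℓ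
lookup⇒GapAt (x ∷ y ∷ ℓ) zero    1≤κ refl =
  subst (λ z → GapAt (y ∸ x) 1 (x ∷ z ∷ ℓ)) (m∸n+n≡m x≤y) here
  where
  x≤y : x ≤ y
  -- If `y ≤ x`, truncation would make the difference `0`, against `1 ≤ κ`.
  x≤y = ≰⇒≥ λ y≤x → <-irrefl (sym (m≤n⇒m∸n≡0 y≤x)) 1≤κ
lookup⇒GapAt (x ∷ y ∷ ℓ) (suc i) 1≤κ eq   = there (lookup⇒GapAt (y ∷ ℓ) i 1≤κ eq)

-- `2n∈` supplies an index of a long gap, so the maximum in `α` is attained by such an index and is
-- not the default `0`.
α-GapAt : ∀ n G → 1 ≤ 2 * n → MaxDifference (2 * n) G → GapAt (2 * n) (α n G) (elements G)
α-GapAt n G 1≤2n (_ , 2n∈) = fromIndex (∈-map⁻ (suc ∘ toℕ) α∈)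
  where
  isLong = λ i → lookup (differences G) i ≟ 2 * n
  α∈ = max-∈ (s≤s z≤n)
    (∈-map⁺ (suc ∘ toℕ) (∈-filter⁺ isLong (∈-allFin (Any.index 2n∈)) (sym (lookup-index 2n∈))))
  fromIndex : _ → GapAt (2 * n) (α n G) (elements G)
  fromIndex (i , i∈ , eq) = subst (λ a → GapAt (2 * n) a (elements G)) (sym eq)
    (lookup⇒GapAt (elements G) i 1≤2n (proj₂ (∈-filter⁻ isLong {xs = allFin _} i∈)))

-- shift a ℓ is, definitionally, spread (suc a) (0 ∷ ℓ).
spread : ℕ → List ℕ → List ℕ
spread a ℓ = map (_+ 1) (take a ℓ) ++ map (_+ 2) (drop a ℓ)

-- Effect of the shift on gaps.

module _ {κ : ℕ} where

  private
    slack : ∀ c x y → y ≤ κ + x → y + c ≤ κ + 1 + (x + c)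
    slack c x y p = begin
      y + c             ≤⟨ +-monoˡ-≤ c p ⟩
      κ + x + c         ≡⟨ +-assoc κ x c ⟩
      κ + (x + c)       ≤⟨ +-monoˡ-≤ (x + c) (m≤m+n κ 1) ⟩
      κ + 1 + (x + c)   ∎
      where open ≤-Reasoning

  -- Neighbours on the same side of the cut move by the same amount; only the pair straddling it
  -- gains 1.
  spread-within : ∀ a {ℓ} → GapsWithin κ ℓ → GapsWithin (κ + 1) (spread a ℓ)
  spread-within zero          []       = []
  spread-within zero          [-]      = [-]
  spread-within zero          (_∷_ {x} {y} p ps) = slack 2 x y p ∷ spread-within zero ps
  spread-within (suc a)       []       = []
  spread-within (suc zero)    [-]      = [-]
  spread-within (suc (suc a)) [-]      = [-]
  spread-within (suc zero)    (_∷_ {x} {y} p ps) = (begin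
      y + 2             ≤⟨ +-monoˡ-≤ 2 p ⟩
      κ + x + 2         ≡⟨ regroup κ x ⟩
      κ + 1 + (x + 1)   ∎) ∷ spread-within zero ps
    where
    open ≤-Reasoning
    regroup : ∀ k x → k + x + 2 ≡ k + 1 + (x + 1)
    regroup = solve-∀
  spread-within (suc (suc a)) (_∷_ {x} {y} p ps) = slack 1 x y p ∷ spread-within (suc a) ps

  spread-gap : ∀ {a ℓ} → GapAt κ a ℓ → κ + 1 ∈ₗ gaps (spread a ℓ)
  spread-gap (here {x}) =
    here (sym (trans (cong (_∸ (x + 1)) (regroup κ x)) (m+n∸n≡m (κ + 1) (x + 1))))
    where
    regroup : ∀ k x → k + x + 2 ≡ k + 1 + (x + 1)
    regroup = solve-∀
  spread-gap (there here)         = there (spread-gap here)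
  spread-gap (there gap@(there _)) = there (spread-gap gap)

  -- Where one side has its long gap and the other does not, the difference of
  -- consecutive entries would have to be both κ + 1 and at most κ.
  private
    clash : ∀ {A : Set} {x x′ y y′} → x + 1 ≡ x′ + 1 → y ≡ κ + x → y′ ≤ κ + x′ → y + 2 ≡ y′ + 1 → A
    clash {x = x} {x′} {y} {y′} ex refl y′≤ ey = contradiction y′≤ (<⇒≱ (begin-strict
      κ + x′    ≡⟨ cong (κ +_) (+-cancelʳ-≡ 1 x x′ ex) ⟨
      κ + x     <⟨ n<1+n _ ⟩
      suc (κ + x)  ≡⟨ +-cancelʳ-≡ 1 (suc (κ + x)) y′ (trans (sym (+-suc (κ + x) 1)) ey) ⟩
      y′        ∎))
      where open ≤-Reasoning

  -- Scanning both lists from the left, the two cuts must be reached together. Up to that point both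
  -- sides are shifted by 1 and afterwards by 2, so the shifts cancel.
  spread-injective : ∀ {a a′ ℓ ℓ′} → GapAt κ a ℓ → GapAt κ a′ ℓ′ →
                     GapsWithin κ ℓ → GapsWithin κ ℓ′ → spread a ℓ ≡ spread a′ ℓ′ → ℓ ≡ ℓ′
  spread-injective here here _ _ eq =
    let ex , es = ∷-injective eq
    in cong₂ _∷_ (+-cancelʳ-≡ 1 _ _ ex) (map-injective (λ {x} {y} → +-cancelʳ-≡ 2 x y) es)
  spread-injective here (there _) _ (y′≤ ∷ _) eq =
    let ex , es = ∷-injective eq in clash ex refl y′≤ (proj₁ (∷-injective es))
  spread-injective (there _) here (y≤ ∷ _) _ eq =
    let ex , es = ∷-injective eq in clash (sym ex) refl y≤ (sym (proj₁ (∷-injective es)))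
  spread-injective (there gap) (there gap′) (_ ∷ ps) (_ ∷ ps′) eq =
    let ex , es = ∷-injective eq
    in cong₂ _∷_ (+-cancelʳ-≡ 1 _ _ ex) (spread-injective gap gap′ ps ps′ es)

-- Size and members of the shifted list.

length-shift : ∀ a ℓ → length (shift a ℓ) ≡ length ℓ + 1
length-shift a ℓ = trans (cong suc (trans
    (length-++ (map (_+ 1) (take a ℓ)))
    (trans (cong₂ _+_ (length-map _ (take a ℓ)) (length-map _ (drop a ℓ)))
      (trans (sym (length-++ (take a ℓ))) (cong length (take++drop≡id a ℓ))))))
  (+-comm 1 _)

-- `left` and `κ + left` are the two ends of the long gap. Bounding the two halves by size lets the
-- value of an entry, not its position, decide its shift.
record Cut (κ : ℕ) (a : ℕ) (ℓ : List ℕ) : Set where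
  field
    left     : ℕ
    left∈    : left ∈ₗ ℓ
    right∈   : κ + left ∈ₗ ℓ
    take≤    : All (_≤ left) (take a ℓ)
    right≤   : All (κ + left ≤_) (drop a ℓ)

  split : ∀ {y} → y ∈ₗ ℓ → (y ∈ₗ take a ℓ × y ≤ left) ⊎ (y ∈ₗ drop a ℓ × κ + left ≤ y)
  split y∈ with ∈-++⁻ (take a ℓ) (subst (_ ∈ₗ_) (sym (take++drop≡id a ℓ)) y∈)
  ... | inj₁ y∈t = inj₁ (y∈t , All.lookup take≤ y∈t)
  ... | inj₂ y∈d = inj₂ (y∈d , All.lookup right≤ y∈d)

  shift-∈⁻ : ∀ {x} → x ∈ₗ shift a ℓ →
    x ≡ 1 ⊎ (∃[ y ] y ∈ₗ ℓ × y ≤ left × x ≡ y + 1) ⊎ (∃[ y ] y ∈ₗ ℓ × κ + left ≤ y × x ≡ y + 2)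
  shift-∈⁻ (here eq) = inj₁ eq
  shift-∈⁻ (there x∈) with ∈-++⁻ (map (_+ 1) (take a ℓ)) x∈
  ... | inj₁ x∈t = let y , y∈ , eq = ∈-map⁻ (_+ 1) x∈t in
    inj₂ (inj₁ (y , subst (y ∈ₗ_) (take++drop≡id a ℓ) (∈-++⁺ˡ y∈) , All.lookup take≤ y∈ , eq))
  ... | inj₂ x∈d = let y , y∈ , eq = ∈-map⁻ (_+ 2) x∈d in
    inj₂ (inj₂ (y , subst (y ∈ₗ_) (take++drop≡id a ℓ) (∈-++⁺ʳ (take a ℓ) y∈)
                  , All.lookup right≤ y∈ , eq))

  shift-∈⁺ˡ : ∀ {y} → 1 ≤ κ → y ∈ₗ ℓ → y ≤ left → y + 1 ∈ₗ shift a ℓ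
  shift-∈⁺ˡ 1≤κ y∈ y≤ with split y∈
  ... | inj₁ (y∈t , _) = there (∈-++⁺ˡ (∈-map⁺ (_+ 1) y∈t))
  -- Positivity of `κ` keeps the two halves disjoint.
  ... | inj₂ (_ , y≥)  = contradiction (≤-trans (+-monoˡ-≤ left 1≤κ) (≤-trans y≥ y≤)) (<-irrefl refl)

  shift-∈⁺ʳ : ∀ {y} → 1 ≤ κ → y ∈ₗ ℓ → κ + left ≤ y → y + 2 ∈ₗ shift a ℓ
  shift-∈⁺ʳ 1≤κ y∈ y≥ with split y∈
  ... | inj₁ (_ , y≤)  = contradiction (≤-trans (+-monoˡ-≤ left 1≤κ) (≤-trans y≥ y≤)) (<-irrefl refl)
  ... | inj₂ (y∈d , _) = there (∈-++⁺ʳ (map (_+ 1) (take a ℓ)) (∈-map⁺ (_+ 2) y∈d))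

GapAt⇒Cut : ∀ {κ a ℓ} → AllPairs _<_ ℓ → GapAt κ a ℓ → Cut κ a ℓ
GapAt⇒Cut (_ ∷ y< ∷ _) (here {x}) = record
  { left = x ; left∈ = here refl ; right∈ = there (here refl)
  ; take≤ = ≤-refl ∷ [] ; right≤ = ≤-refl ∷ All.map <⇒≤ y< }
GapAt⇒Cut (x< ∷ ℓ↗) (there gap) = record
  { left = left ; left∈ = there left∈ ; right∈ = there right∈
  ; take≤ = <⇒≤ (All.lookup x< left∈) ∷ take≤ ; right≤ = right≤ }
  where open Cut (GapAt⇒Cut ℓ↗ gap)

-- Gapsets

maximum : FinSet → ℕ
maximum A = max 0 (elements A)

≤maximum : ∀ A {x} → x ∈ A → x ≤ maximum A
≤maximum A = All.lookup (xs≤max 0 (elements A))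

module Gapset (G : FinSet) (gapset : IsGapset G) {m : ℕ} (m-min : IsMin (NonMember G) m) where

  1≤m : 1 ≤ m
  1≤m = proj₁ (proj₁ m-min)

  m∉G : m ∉ G
  m∉G = proj₂ (proj₁ m-min)

  <m⇒∈ : ∀ {x} → 1 ≤ x → x < m → x ∈ G
  <m⇒∈ {x} 1≤x x<m = decidable-stable (x ∈? elements G) λ x∉ →
    <⇒≱ x<m (proj₂ m-min (1≤x , x∉))

  -- Induction: `m + k * m` in `G` would force `m` or `k * m` into `G`.
  multiple-∉ : ∀ k → 1 ≤ k → k * m ∉ G
  multiple-∉ (suc zero)    _ km∈ = m∉G (subst (_∈ G) (*-identityˡ m) km∈)
  multiple-∉ (suc k@(suc j)) _ km∈ = [ m∉G , multiple-∉ k (s≤s z≤n) ]′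
    (gapset m (k * m) 1≤m (≤-trans 1≤m (m≤m+n m (j * m))) km∈)

  -- If `m` were 1, every element of `G` would be a multiple of `m`.
  2≤m : ∀ {x} → x ∈ G → 2 ≤ m
  2≤m {x} x∈ = ≤∧≢⇒< 1≤m λ 1≡m → multiple-∉ x (All.lookup (positive G) x∈)
    (subst (_∈ G) (trans (sym (*-identityʳ x)) (cong (x *_) 1≡m)) x∈)

  -- The values from `0` to `F` are covered by `E` together with its reflection under `F ∸_`.
  ∈⇒<2*size : ∀ {F} → F ∈ G → suc F ≤ 2 * size G
  ∈⇒<2*size {F} F∈ = ≤-trans (⊆-range⇒≤ F (E ++ map (F ∸_) E) cover) (≤-reflexive (trans
    (length-++ E) (cong (length E +_) (trans (length-map _ E) (sym (+-identityʳ _))))))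
    where
    E = elements G
    cover : ∀ x → x ≤ F → x ∈ₗ E ++ map (F ∸_) E
    -- The gapset property needs positive summands, so the trivial splittings of `F`, at `0` and at
    -- `F` itself, are treated apart.
    cover zero    _   = ∈-++⁺ʳ E (subst (_∈ₗ map (F ∸_) E) (n∸n≡0 F) (∈-map⁺ (F ∸_) F∈))
    cover x@(suc _) x≤F with m≤n⇒m<n∨m≡n x≤F
    ... | inj₂ refl = ∈-++⁺ˡ F∈
    ... | inj₁ x<F with gapset x (F ∸ x) (s≤s z≤n) (m<n⇒0<n∸m x<F)
                          (subst (_∈ G) (sym (m+[n∸m]≡n x≤F)) F∈)
    ...   | inj₁ x∈   = ∈-++⁺ˡ x∈
    ...   | inj₂ F∸x∈ = ∈-++⁺ʳ E (subst (_∈ₗ map (F ∸_) E) (m∸[m∸n]≡n x≤F) (∈-map⁺ (F ∸_) F∸x∈))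

-- `conductor G` reduces definitionally to `suc (maximum G)`.
depth-bounds : ∀ {G m k} → multiplicity G ≡ m → depth G ≡ suc k →
               k * m < suc (maximum G) × suc (maximum G) ≤ suc k * m
depth-bounds {G} refl = ⌈/⌉-bounds {{>-nonZero (proj₁ (proj₁ (proj₂ (multiplicity-exists G))))}}

-- The image of a pure sparse gapset.

module PureSparse (n g : ℕ) (1≤n : 1 ≤ n) (G : FinSet) (G∈ : 𝒢 (2 * n) g G)
                  {m : ℕ} (m-min : IsMin (NonMember G) m) where

  open Gapset G (proj₁ G∈) m-min public

  private
    M = maximum G

  2≤2n : 2 ≤ 2 * n
  2≤2n = *-monoʳ-≤ 2 1≤n

  1≤2n : 1 ≤ 2 * n
  1≤2n = <⇒≤ 2≤2n

  gap : GapAt (2 * n) (α n G) (elements G)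
  gap = α-GapAt n G 1≤2n (proj₁ (proj₂ G∈))

  open Cut (GapAt⇒Cut (increasing G) gap) public

  M∈ : M ∈ G
  M∈ = max-∈ (All.lookup (positive G) left∈) left∈

  M<2g : suc M ≤ 2 * g
  M<2g = subst (λ s → suc M ≤ 2 * s) (proj₂ (proj₂ G∈)) (∈⇒<2*size M∈)

  -- The leading `1` of `σ n G` is the image of a virtual entry `0`; prepending it lets the results
  -- on `spread` cover all of `σ n G`.
  gap₀ : GapAt (2 * n) (suc (α n G)) (0 ∷ elements G)
  gap₀ = cons gap
    where
    cons : ∀ {κ a ℓ} → GapAt κ a ℓ → GapAt κ (suc a) (0 ∷ ℓ)
    cons p@here      = there p
    cons p@(there _) = there p

  -- The new first gap runs from `0` to the least element, which is 1 because `m` is at least 2.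
  within₀ : GapsWithin (2 * n) (0 ∷ elements G)
  within₀ = cons (increasing G) (gaps≤⇒within _ (proj₁ (proj₁ (proj₂ G∈))))
                 (<m⇒∈ ≤-refl (2≤m M∈))
    where
    cons : ∀ {ℓ} → AllPairs _<_ ℓ → GapsWithin (2 * n) ℓ → 1 ∈ₗ ℓ → GapsWithin (2 * n) (0 ∷ ℓ)
    cons {x ∷ ℓ} (x< ∷ _) ps 1∈ = ≤-trans (x≤1 1∈) (≤-trans 1≤2n (m≤m+n _ 0)) ∷ ps
      where
      x≤1 : 1 ∈ₗ x ∷ ℓ → x ≤ 1
      x≤1 (here eq)  = ≤-reflexive (sym eq)
      x≤1 (there 1∈) = <⇒≤ (All.lookup x< 1∈)

  σ-≤ : ∀ {x} → x ∈ σ n G → x ≤ M + 2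
  σ-≤ x∈ with shift-∈⁻ x∈
  ... | inj₁ refl                       = ≤-trans (s≤s z≤n) (m≤n+m 2 M)
  ... | inj₂ (inj₁ (y , y∈ , _ , refl)) = +-mono-≤ (≤maximum G y∈) (s≤s z≤n)
  ... | inj₂ (inj₂ (y , y∈ , _ , refl)) = +-monoˡ-≤ 2 (≤maximum G y∈)

  -- `M` lies beyond the long gap, so it moves by 2, the largest shift.
  maximum-σ : maximum (σ n G) ≡ M + 2
  maximum-σ = ≤-antisym (max≤v⁺ z≤n (All.tabulate σ-≤))
    (≤maximum (σ n G) (shift-∈⁺ʳ 1≤2n M∈ (≤maximum G right∈)))

  σ∈𝒞 : 𝒞 (2 * n + 1) (g + 1) (σ n G)
  σ∈𝒞 = All.tabulate (λ x∈ → ≤-trans (σ-≤ x∈) bound)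
      , trans (length-shift (α n G) (elements G)) (cong (_+ 1) (proj₂ (proj₂ G∈)))
      , within⇒gaps≤ (spread-within (suc (α n G)) within₀)
      , spread-gap gap₀
    where
    bound : M + 2 ≤ 2 * (g + 1) ∸ 1
    bound = ∸-monoˡ-≤ 1 (begin
      suc (M + 2)     ≤⟨ +-monoˡ-≤ 2 M<2g ⟩
      2 * g + 2       ≡⟨ *-distribˡ-+ 2 g 1 ⟨
      2 * (g + 1)     ∎)
      where open ≤-Reasoning

  -- If `suc left` were below `m` it would lie in `G`, yet it falls strictly inside the long gap,
  -- whose length is at least 2.
  m≤left+1 : m ≤ suc left
  m≤left+1 = ≮⇒≥ λ left+1<m → absurd (split (<m⇒∈ (s≤s z≤n) left+1<m))
    where
    absurd : ¬ ((suc left ∈ₗ take (α n G) (elements G) × suc left ≤ left)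
              ⊎ (suc left ∈ₗ drop (α n G) (elements G) × 2 * n + left ≤ suc left))
    absurd (inj₁ (_ , p)) = <-irrefl refl p
    absurd (inj₂ (_ , p)) = <-irrefl refl (≤-trans (+-monoˡ-≤ left 2≤2n) p)

  -- The entries from 1 to `m ∸ 1` all lie left of the long gap, so they move by 1 and fill
  -- everything from 2 to `m`.
  initial-∈ : ∀ x → 1 ≤ x → x ≤ m → x ∈ σ n G
  initial-∈ (suc zero)    _ _   = here refl
  initial-∈ (suc (suc x)) _ x<m = subst (_∈ σ n G) (+-comm (suc x) 1)
    (shift-∈⁺ˡ 1≤2n (<m⇒∈ (s≤s z≤n) x<m) (≤-pred (≤-trans x<m m≤left+1)))

  -- A preimage shifted by 1 would be `m` itself; one shifted by 2 would be `m ∸ 1`, which is at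
  -- most `left` and so not beyond the gap.
  m+1∉σ : suc m ∉ σ n G
  m+1∉σ m+1∈ with shift-∈⁻ m+1∈
  ... | inj₁ eq = <⇒≢ (s<s 1≤m) (sym eq)
  ... | inj₂ (inj₁ (y , y∈ , _ , eq)) =
    m∉G (subst (_∈ G) (suc-injective (trans (+-comm 1 y) (sym eq))) y∈)
  ... | inj₂ (inj₂ (y , _ , y≥ , eq)) = <-irrefl refl (begin-strict
    left            <⟨ n<1+n left ⟩
    1 + left        ≤⟨ +-monoˡ-≤ left 1≤2n ⟩
    2 * n + left    ≤⟨ y≥ ⟩
    y               ≤⟨ ≤-pred (subst (_≤ suc left) (suc-injective (trans eq (+-comm y 2))) m≤left+1) ⟩
    left            ∎)
    where open ≤-Reasoning

  2[m+1]∉σ : g ≡ 3 * n + 1 → suc M ≤ 3 * m → 2 * suc m ∉ σ n G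
  2[m+1]∉σ refl M<3m 2m+2∈ with shift-∈⁻ 2m+2∈
  ... | inj₁ eq = contradiction (trans (sym (*-distribˡ-+ 2 1 m)) eq) λ ()
  -- A preimage beyond the gap would be `2 * m`, a multiple of `m`.
  ... | inj₂ (inj₂ (y , y∈ , _ , eq)) = multiple-∉ 2 (s≤s z≤n)
    (subst (_∈ G) (+-cancelʳ-≡ 2 y (2 * m) (trans (sym eq) (2*suc m))) y∈)
    where
    2*suc : ∀ k → 2 * suc k ≡ 2 * k + 2
    2*suc = solve-∀
  -- The genus enters here: `m≥` and `M≥` force `suc M` up to `6 * n + 6`, four above `2 * g`.
  ... | inj₂ (inj₁ (y , y∈ , y≤ , eq)) = <-irrefl refl (begin-strict
    6 * n + 2                               <⟨ m<m+n (6 * n + 2) {4} (s≤s z≤n) ⟩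
    6 * n + 2 + 4                           ≡⟨ regroup₁ n ⟩
    2 * (2 * n + 2) + (2 * n + 2)           ≤⟨ +-monoˡ-≤ _ (*-monoʳ-≤ 2 m≥) ⟩
    2 * m + (2 * n + 2)                     ≡⟨ regroup₂ n m ⟩
    suc (2 * n + (2 * m + 1))               ≤⟨ s≤s M≥ ⟩
    suc M                                   ≤⟨ M<2g ⟩
    2 * (3 * n + 1)                         ≡⟨ regroup₃ n ⟩
    6 * n + 2                               ∎)
    where
    open ≤-Reasoning
    regroup₁ : ∀ n → 6 * n + 2 + 4 ≡ 2 * (2 * n + 2) + (2 * n + 2)
    regroup₁ = solve-∀
    regroup₂ : ∀ n m → 2 * m + (2 * n + 2) ≡ suc (2 * n + (2 * m + 1))
    regroup₂ = solve-∀
    regroup₃ : ∀ n → 2 * (3 * n + 1) ≡ 6 * n + 2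
    regroup₃ = solve-∀
    regroup₄ : ∀ m → 2 * suc m ≡ 2 * m + 1 + 1
    regroup₄ = solve-∀
    regroup₅ : ∀ m → 3 * m ≡ 2 * m + m
    regroup₅ = solve-∀
    y≡ : y ≡ 2 * m + 1
    y≡ = +-cancelʳ-≡ 1 y (2 * m + 1) (trans (sym eq) (regroup₄ m))
    M≥ : 2 * n + (2 * m + 1) ≤ M
    M≥ = ≤-trans (+-monoʳ-≤ (2 * n) (subst (_≤ left) y≡ y≤)) (≤maximum G right∈)
    m≥ : 2 * n + 2 ≤ m
    m≥ = +-cancelˡ-≤ (2 * m) _ _ (begin
      2 * m + (2 * n + 2)         ≡⟨ regroup₂ n m ⟩
      suc (2 * n + (2 * m + 1))   ≤⟨ s≤s M≥ ⟩
      suc M                       ≤⟨ M<3m ⟩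
      3 * m                       ≡⟨ regroup₅ m ⟩
      2 * m + m                   ∎)

  -- Elements of `σ n G` are at most `M + 2`, below `3 * suc m`, so only the multiples `suc m` and
  -- `2 * suc m` need a separate argument; positivity excludes 0.
  σ-isMSet : g ≡ 3 * n + 1 → suc M ≤ 3 * m → IsMSet (suc m) (σ n G)
  σ-isMSet g≡ M<3m = s≤s z≤n , initial-∈ , multiples
    where
    multiples : ∀ x → _ → x ∉ σ n G
    multiples _ (divides 0 refl) x∈ = contradiction (All.lookup (positive (σ n G)) x∈) λ ()
    multiples _ (divides 1 refl) x∈ = m+1∉σ (subst (_∈ σ n G) (*-identityˡ (suc m)) x∈)
    multiples _ (divides 2 refl) x∈ = 2[m+1]∉σ g≡ M<3m x∈
    multiples _ (divides (suc (suc (suc k))) refl) x∈ = <-irrefl refl (begin-strict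
      3 * m + 2                       <⟨ n<1+n _ ⟩
      1 + (3 * m + 2)                 ≡⟨ regroup m ⟩
      3 * suc m                       ≤⟨ *-monoˡ-≤ (suc m) (m≤m+n 3 k) ⟩
      (3 + k) * suc m                 ≤⟨ σ-≤ x∈ ⟩
      M + 2                           ≤⟨ +-monoˡ-≤ 2 (<⇒≤ M<3m) ⟩
      3 * m + 2                       ∎)
      where
      open ≤-Reasoning
      regroup : ∀ m → 1 + (3 * m + 2) ≡ 3 * suc m
      regroup = solve-∀

  -- Passing from `k * m` to `k * suc m` costs `k`, at most 2, which the shift of the maximum by 2
  -- pays for.
  mSetDepth-σ : ∀ k → 1 ≤ k → k ≤ 2 → k * m < suc M → suc M ≤ suc k * m →
                mSetDepth (suc m) (σ n G) ≡ suc k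
  mSetDepth-σ k 1≤k k≤2 km≤M M<km+m =
    trans (cong (λ c → ⌈ c / suc m ⌉) maximum-σ) (⌈/⌉-unique lower upper)
    where
    open ≤-Reasoning
    -- The depth of `G` gives only `k * m ≤ M`; equality fails because `M` lies in `G` and multiples
    -- of `m` do not.
    km<M : k * m < M
    km<M = ≤∧≢⇒< (≤-pred km≤M) λ km≡M →
      multiple-∉ k 1≤k (subst (_∈ G) (sym km≡M) M∈)
    lower : k * suc m < M + 2
    lower = begin-strict
      k * suc m     ≡⟨ *-suc k m ⟩
      k + k * m     ≡⟨ +-comm k (k * m) ⟩
      k * m + k     <⟨ +-mono-<-≤ km<M k≤2 ⟩
      M + 2         ∎
    upper : M + 2 ≤ suc k * suc m
    upper = begin
      M + 2                 ≡⟨ +-suc M 1 ⟩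
      suc M + 1             ≤⟨ +-mono-≤ M<km+m (s≤s z≤n) ⟩
      suc k * m + suc k     ≡⟨ +-comm (suc k * m) (suc k) ⟩
      suc k + suc k * m     ≡⟨ *-suc (suc k) m ⟨
      suc k * suc m         ∎

-- Injectivity and assembly.

σ-injective : ∀ n g → 1 ≤ n → ∀ G G′ → 𝒢 (2 * n) g G → 𝒢 (2 * n) g G′ → σ n G ≐ σ n G′ → G ≐ G′
σ-injective n g 1≤n G G′ G∈ G′∈ σ≐ x =
  mk⇔ (subst (x ∈ₗ_) elements≡) (subst (x ∈ₗ_) (sym elements≡))
  where
  module P  = PureSparse n g 1≤n G G∈ (proj₂ (multiplicity-exists G))
  module P′ = PureSparse n g 1≤n G′ G′∈ (proj₂ (multiplicity-exists G′))
  shifts≡ : elements (σ n G) ≡ elements (σ n G′)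
  shifts≡ = increasing-≡ (increasing (σ n G)) (increasing (σ n G′))
    (λ {z} → Equivalence.to (σ≐ z)) (λ {z} → Equivalence.from (σ≐ z))
  elements≡ : elements G ≡ elements G′
  -- Injectivity is applied to the lists with `0` prepended, which is then stripped off.
  elements≡ = proj₂ (∷-injective (spread-injective P.gap₀ P′.gap₀ P.within₀ P′.within₀ shifts≡))

mainTheorem3 : ∀ (n g : ℕ) → 1 ≤ n → g ≡ 3 * n + 1 →
    (∀ G → 𝒢[q≤3] (2 * n) g G → 𝒞 (2 * n + 1) (g + 1) (σ n G))
    × (∀ G G′ → 𝒢[q≤3] (2 * n) g G → 𝒢[q≤3] (2 * n) g G′ → σ n G ≐ σ n G′ → G ≐ G′)
    × (∀ G m → 𝒢 (2 * n) g G → depth G ≡ 2 → multiplicity G ≡ m →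
    IsMSet (suc m) (σ n G) × mSetDepth (suc m) (σ n G) ≡ 2)
    × (∀ G m → 𝒢 (2 * n) g G → depth G ≡ 3 → multiplicity G ≡ m →
    IsMSet (suc m) (σ n G) × mSetDepth (suc m) (σ n G) ≡ 3)
mainTheorem3 n g 1≤n g≡ =
    (λ G (G∈ , _) → PureSparse.σ∈𝒞 n g 1≤n G G∈ (proj₂ (multiplicity-exists G)))
  , (λ G G′ (G∈ , _) (G′∈ , _) → σ-injective n g 1≤n G G′ G∈ G′∈)
  , (λ G m G∈ depth≡2 m≡ →
       let m<c , c≤2m = depth-bounds {G} m≡ depth≡2
           open PureSparse n g 1≤n G G∈
             (subst (IsMin (NonMember G)) m≡ (proj₂ (multiplicity-exists G)))
       -- The depth 2 bound is weakened to `3 * m`, so both depths share one argument.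
       in σ-isMSet g≡ (≤-trans c≤2m (*-monoˡ-≤ m (n≤1+n 2)))
        , mSetDepth-σ 1 ≤-refl (n≤1+n 1) m<c c≤2m)
  , (λ G m G∈ depth≡3 m≡ →
       let 2m<c , c≤3m = depth-bounds {G} m≡ depth≡3
           open PureSparse n g 1≤n G G∈
             (subst (IsMin (NonMember G)) m≡ (proj₂ (multiplicity-exists G)))
       in σ-isMSet g≡ c≤3m
        , mSetDepth-σ 2 (n≤1+n 1) ≤-refl 2m<c c≤3m)
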